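{- For any tree $T$, $\rho^{0}(T)\leq L_2(T)\leq 2\rho^{0}(T)$. Moreover, $\rho^{0}(T)= L_2(T)$ if and only if $T\in \mathcal{T}$, where $\mathcal{T}$ is the set of trees $T$ whose vertex set can be partitioned into two disjoint subsets $S_0$ and $R_0$ (with $R_0$ possibly empty) such that: (i) $T[S_0]=aK_2$ for some positive integer $a$, and each of these copies of $K_2$ has at least one vertex with degree $1$ in $T$; (ii) for each $r\in R_0$, $|N(r)\cap S_0|=1$.
   Context: All graphs (in particular trees) are finite, undirected, simple and nontrivial (at least two vertices). $N(v)$ is the open neighbourhood of $v$ and $N[v]=\{v\}\cup N(v)$ the closed neighbourhood. $T[S]$ is the subgraph induced by $S$, and $aK_2$ is the vertex-disjoint union of $a$ copies of $K_2$. An open packing of $G$ is a set $S\subseteq V(G)$ with $|N(v)\cap S|\le 1$ for every vertex $v$ of $G$; the open packing number $\rho^0(G)$ is the maximum cardinality of an open packing. A set $B\subseteq V(G)$ is a $2$-limited packing if $|N[v]\cap B|\le 2$ for every vertex $v$ of $G$; $L_2(G)$ is the maximum cardinality of a $2$-limited packing in $G$. -}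

module Defs where

open import Data.Fin.Base using (Fin)
import Data.Fin.Properties as Fin
open import Data.Fin.Subset
open import Data.List.Base using (List; []; _∷_; _∷ʳ_; _++_; [_]; map; filter; length)
open import Data.List.Extrema.Nat using (max; xs≤max; argmax-sel)
open import Data.List.Membership.Propositional using () renaming (_∈_ to _∈ˡ_)
open import Data.List.Membership.Propositional.Properties
  using (∈-map⁺; ∈-map⁻; ∈-filter⁺; ∈-filter⁻; ∈-++⁺ˡ; ∈-++⁺ʳ)
open import Data.List.Relation.Unary.All as All using ()
open import Data.List.Relation.Unary.Any using (here)
open import Data.List.Relation.Unary.Linked using (Linked)
open import Data.List.Relation.Unary.Unique.Propositional using (Unique)
open import Data.Nat.Base using (ℕ; zero; suc; _≤_; _<_)
open import Data.Nat.Properties using (_≤?_; ≤-trans; ≤-reflexive; n≤0⇒n≡0)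
open import Data.Product.Base using (Σ-syntax; ∃-syntax; _×_; _,_; proj₁; proj₂)
open import Data.Sum.Base using (inj₁; inj₂)
open import Data.Vec.Base using (_∷_; []; tabulate)
open import Function.Base using (id)
open import Function.Bundles using (_↔_; _⇔_; Inverse)
open import Level using (0ℓ)
open import Relation.Binary.Construct.Closure.ReflexiveTransitive using (Star)
open import Relation.Binary.Core using (Rel)
import Relation.Binary.Definitions as B
open import Relation.Binary.PropositionalEquality
  using (_≡_; _≢_; refl; sym; trans; ≢-sym)
open import Relation.Nullary using (¬_; does; ¬?; _×-dec_)
open import Relation.Unary using (Pred; Decidable)

record SimpleGraph (V : Set) : Set₁ where
  field
    Adj    : Rel V 0ℓ
    adj?   : B.Decidable Adj
    symm   : B.Symmetric Adj
    irrefl : B.Irreflexive _≡_ Adj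

open SimpleGraph public

private
  variable
    V W : Set
    n   : ℕ

Connected : SimpleGraph V → Set
Connected G = ∀ u v → Star (Adj G) u v

-- v₀ , v₁ , … , vₖ are distinct with k ≥ 2, and v₀ v₁ … vₖ v₀ is a closed walk.
record Cycle (G : SimpleGraph V) : Set where
  field
    start    : V
    rest     : List V
    long     : 2 ≤ length rest
    distinct : Unique (start ∷ rest)
    closed   : Linked (Adj G) (start ∷ (rest ∷ʳ start))

record IsTree (G : SimpleGraph V) : Set where
  field
    connected : Connected G
    acyclic   : ¬ Cycle G

infix 4 _≅_

record _≅_ (G : SimpleGraph V) (H : SimpleGraph W) : Set where
  field
    bijection : V ↔ W
  open Inverse bijection public using (to; from)
  field
    preserves : ∀ u v → Adj G u v ⇔ Adj H (to u) (to v)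

K : ∀ m → SimpleGraph (Fin m)
K m = record
  { Adj    = _≢_
  ; adj?   = λ u v → ¬? (u Fin.≟ v)
  ; symm   = ≢-sym
  ; irrefl = λ u≡v u≢v → u≢v u≡v
  }

infixr 7 _·_

-- The vertex-disjoint union of a copies of G; (i , v) is the vertex v of the i-th copy.
_·_ : ∀ a → SimpleGraph V → SimpleGraph (Fin a × V)
a · G = record
  { Adj    = λ (i , u) (j , v) → i ≡ j × Adj G u v
  ; adj?   = λ (i , u) (j , v) → (i Fin.≟ j) ×-dec adj? G u v
  ; symm   = λ (i≡j , uv) → sym i≡j , symm G uv
  ; irrefl = λ { refl (_ , uu) → irrefl G refl uu }
  }

infix 8 _⟨_⟩

_⟨_⟩ : SimpleGraph (Fin n) → (S : Subset n) → SimpleGraph (Σ[ v ∈ Fin n ] v ∈ S)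
G ⟨ S ⟩ = record
  { Adj    = λ u v → Adj G (proj₁ u) (proj₁ v)
  ; adj?   = λ u v → adj? G (proj₁ u) (proj₁ v)
  ; symm   = symm G
  ; irrefl = λ { refl uu → irrefl G refl uu }
  }

N : SimpleGraph (Fin n) → Fin n → Subset n
N G v = tabulate λ u → does (adj? G v u)

N[_,_] : SimpleGraph (Fin n) → Fin n → Subset n
N[ G , v ] = ⁅ v ⁆ ∪ N G v

degree : SimpleGraph (Fin n) → Fin n → ℕ
degree G v = ∣ N G v ∣

OpenPacking : SimpleGraph (Fin n) → Pred (Subset n) 0ℓ
OpenPacking G S = ∀ v → ∣ N G v ∩ S ∣ ≤ 1

openPacking? : (G : SimpleGraph (Fin n)) → Decidable (OpenPacking G)
openPacking? G S = Fin.all? λ v → ∣ N G v ∩ S ∣ ≤? 1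

TwoLimitedPacking : SimpleGraph (Fin n) → Pred (Subset n) 0ℓ
TwoLimitedPacking G B = ∀ v → ∣ N[ G , v ] ∩ B ∣ ≤ 2

twoLimitedPacking? : (G : SimpleGraph (Fin n)) → Decidable (TwoLimitedPacking G)
twoLimitedPacking? G B = Fin.all? λ v → ∣ N[ G , v ] ∩ B ∣ ≤? 2

subsets : ∀ n → List (Subset n)
subsets zero    = [ [] ]
subsets (suc n) = map (outside ∷_) (subsets n) ++ map (inside ∷_) (subsets n)

-- The default value 0 is only relevant if no subset satisfies P; the empty set
-- satisfies both packing predicates.
maxCard : {P : Pred (Subset n) 0ℓ} → Decidable P → ℕ
maxCard {n} P? = max 0 (map ∣_∣ (filter P? (subsets n)))

∈-subsets : (S : Subset n) → S ∈ˡ subsets n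
∈-subsets []            = here refl
∈-subsets (outside ∷ S) = ∈-++⁺ˡ (∈-map⁺ (outside ∷_) (∈-subsets S))
∈-subsets (inside  ∷ S) = ∈-++⁺ʳ _ (∈-map⁺ (inside ∷_) (∈-subsets S))

∣S∣≤maxCard : {P : Pred (Subset n) 0ℓ} (P? : Decidable P) →
              ∀ {S} → P S → ∣ S ∣ ≤ maxCard P?
∣S∣≤maxCard P? {S} PS =
  All.lookup (xs≤max 0 _) (∈-map⁺ ∣_∣ (∈-filter⁺ P? (∈-subsets S) PS))

maxCard-attained : {P : Pred (Subset n) 0ℓ} (P? : Decidable P) →
                   ∀ {S} → P S → ∃[ M ] P M × ∣ M ∣ ≡ maxCard P?
maxCard-attained {n} P? {S} PS
  with argmax-sel id 0 (map ∣_∣ (filter P? (subsets n)))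
... | inj₁ max≡0 = S , PS ,
  trans (n≤0⇒n≡0 (≤-trans (∣S∣≤maxCard P? PS) (≤-reflexive max≡0))) (sym max≡0)
... | inj₂ max∈ with ∈-map⁻ ∣_∣ max∈
...   | M , M∈ , max≡∣M∣ = M , proj₂ (∈-filter⁻ P? {xs = subsets n} M∈) , sym max≡∣M∣

ρ⁰ : SimpleGraph (Fin n) → ℕ
ρ⁰ G = maxCard (openPacking? G)

L₂ : SimpleGraph (Fin n) → ℕ
L₂ G = maxCard (twoLimitedPacking? G)

infix 4 _∈𝒯

record _∈𝒯 (T : SimpleGraph (Fin n)) : Set where
  field
    isTree       : IsTree T
    S₀ R₀        : Subset n
    covering     : S₀ ∪ R₀ ≡ ⊤
    disjoint     : S₀ ∩ R₀ ≡ ⊥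
    a            : ℕ
    a-positive   : 0 < a
    iso          : T ⟨ S₀ ⟩ ≅ a · K 2
    leafInCopy   : ∀ i → ∃[ j ] degree T (proj₁ (_≅_.from iso (i , j))) ≡ 1
    oneNeighbour : ∀ {r} → r ∈ R₀ → ∣ N T r ∩ S₀ ∣ ≡ 1

{-# OPTIONS --safe #-}

-- ρ⁰ ≤ L₂ because an open packing is a 2-limited packing. For L₂ ≤ 2ρ⁰, join two
-- vertices of a 2-limited packing B by a conflict when they have a common neighbour:
-- each vertex is the middle of at most one conflict, so in a forest the conflicts can
-- be properly 2-coloured, and the colour classes are open packings.
--
-- If T ∈ 𝒯, then S₀ is an open packing with 2a vertices, and the a ends opposite to the
-- chosen leaves dominate T, so that L₂ ≤ 2a. Conversely, let S be an open packing with
-- L₂ vertices. Adding x ∉ S violates 2-limitedness, so x has a neighbour in S that is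
-- itself matched in S; hence S induces a perfect matching and every x ∉ S has exactly
-- one neighbour in S. If an edge u v of this matching had no leaf, with further
-- neighbours x of u and y of v, then (S ∖ {u}) ∪ {x , y} would be a larger 2-limited
-- packing, because T has no cycle of length 3, 4 or 5.

module Submission where

open import Defs
open import Data.Bool.Base using (Bool; true; false; not)
import Data.Bool.Properties as Bool
open import Data.Empty using (⊥-elim) renaming (⊥ to Absurd)
import Data.Fin.Base as Fin
open import Data.Fin.Base using (Fin; zero; suc; opposite; fromℕ<)
import Data.Fin.Properties as Fin
open import Data.Fin.Subset
open import Data.Fin.Subset.Induction using (Acc; acc; ⊂-wellFounded)
open import Data.Fin.Subset.Properties
open import Data.List.Base using (List; []; _∷_; _∷ʳ_; length; [_])
import Data.List.Membership.DecPropositional as DecMembership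
open import Data.List.Membership.Propositional using () renaming (_∈_ to _∈ˡ_)
open import Data.List.Relation.Unary.All as All using (All; []; _∷_)
import Data.List.Relation.Unary.All.Properties as All
open import Data.List.Relation.Unary.AllPairs using ([]; _∷_)
open import Data.List.Relation.Unary.Any using (here; there)
open import Data.List.Relation.Unary.Linked using (Linked; [-]; _∷_)
open import Data.List.Relation.Unary.Unique.Propositional using (Unique)
open import Data.Nat.Base using (ℕ; zero; suc; _+_; _*_; _≤_; _<_; z≤n; s≤s)
open import Data.Nat.Properties
open import Data.Product.Base using (Σ-syntax; ∃-syntax; _×_; _,_; proj₁; proj₂)
open import Data.Sum.Base using (_⊎_; inj₁; inj₂)
open import Data.Vec.Base using ([]; _∷_; tabulate; here; there)
open import Data.Vec.Functional using (updateAt)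
open import Data.Vec.Functional.Properties using (updateAt-updates; updateAt-minimal)
open import Data.Vec.Properties using (lookup∘tabulate; []=⇒lookup; lookup⇒[]=)
open import Function.Base using (_∘_)
open import Function.Bundles using (_⇔_; mk⇔; mk↔ₛ′; Equivalence; Injection; Inverse)
open import Function.Properties.Inverse using (↔⇒↣; ↔-sym)
open import Level using (0ℓ)
open import Relation.Binary.Construct.Closure.ReflexiveTransitive using (Star; ε; _◅_)
open import Relation.Binary.Core using (Rel)
open import Relation.Binary.Definitions using (tri<; tri≈; tri>)
open import Relation.Binary.PropositionalEquality
  using (_≡_; _≢_; refl; sym; trans; cong; subst; subst₂; ≢-sym)
open import Relation.Nullary using (¬_; Dec; yes; no; does; ¬?; _×-dec_; contradiction)
open import Relation.Nullary.Decidable using (dec-true; decidable-stable)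
open import Relation.Unary using (Pred; Decidable)

private
  variable
    n k l : ℕ
    p S : Subset n
    x y z : Fin n

-- Cardinalities of finite subsets.

∣p∪q∣≤∣p∣+∣q∣ : ∀ (p q : Subset n) → ∣ p ∪ q ∣ ≤ ∣ p ∣ + ∣ q ∣
∣p∪q∣≤∣p∣+∣q∣ []            []            = z≤n
∣p∪q∣≤∣p∣+∣q∣ (outside ∷ p) (outside ∷ q) = ∣p∪q∣≤∣p∣+∣q∣ p q
∣p∪q∣≤∣p∣+∣q∣ (outside ∷ p) (inside  ∷ q) =
  ≤-trans (s≤s (∣p∪q∣≤∣p∣+∣q∣ p q)) (≤-reflexive (sym (+-suc ∣ p ∣ ∣ q ∣)))
∣p∪q∣≤∣p∣+∣q∣ (inside  ∷ p) (outside ∷ q) = s≤s (∣p∪q∣≤∣p∣+∣q∣ p q)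
∣p∪q∣≤∣p∣+∣q∣ (inside  ∷ p) (inside  ∷ q) =
  s≤s (≤-trans (∣p∪q∣≤∣p∣+∣q∣ p q) (+-monoʳ-≤ ∣ p ∣ (n≤1+n ∣ q ∣)))

p⊆q∪r⇒∣p∣≤∣q∣+∣r∣ : ∀ {p : Subset n} q r → p ⊆ q ∪ r → ∣ p ∣ ≤ ∣ q ∣ + ∣ r ∣
p⊆q∪r⇒∣p∣≤∣q∣+∣r∣ q r p⊆q∪r = ≤-trans (p⊆q⇒∣p∣≤∣q∣ p⊆q∪r) (∣p∪q∣≤∣p∣+∣q∣ q r)

∣p∪⁅x⁆∣≤1+∣p∣ : ∀ (p : Subset n) x → ∣ p ∪ ⁅ x ⁆ ∣ ≤ suc ∣ p ∣
∣p∪⁅x⁆∣≤1+∣p∣ p x = begin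
  ∣ p ∪ ⁅ x ⁆ ∣      ≤⟨ ∣p∪q∣≤∣p∣+∣q∣ p ⁅ x ⁆ ⟩
  ∣ p ∣ + ∣ ⁅ x ⁆ ∣  ≡⟨ cong (∣ p ∣ +_) (∣⁅x⁆∣≡1 x) ⟩
  ∣ p ∣ + 1          ≡⟨ +-comm ∣ p ∣ 1 ⟩
  suc ∣ p ∣          ∎
  where open ≤-Reasoning

x∉p⇒∣p∣<∣p∪⁅x⁆∣ : x ∉ p → ∣ p ∣ < ∣ p ∪ ⁅ x ⁆ ∣
x∉p⇒∣p∣<∣p∪⁅x⁆∣ {x = x} {p = p} x∉p =
  p⊂q⇒∣p∣<∣q∣ (p⊆p∪q ⁅ x ⁆ , x , q⊆p∪q p ⁅ x ⁆ (x∈⁅x⁆ x) , x∉p)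

∣p∣≤1+∣p-x∣ : ∀ (p : Subset n) x → ∣ p ∣ ≤ suc ∣ p - x ∣
∣p∣≤1+∣p-x∣ p x = ≤-trans (p⊆q⇒∣p∣≤∣q∣ p⊆) (∣p∪⁅x⁆∣≤1+∣p∣ (p - x) x)
  where
  p⊆ : p ⊆ (p - x) ∪ ⁅ x ⁆
  p⊆ {y} y∈p with y Fin.≟ x
  ... | yes refl = q⊆p∪q (p - x) ⁅ x ⁆ (x∈⁅x⁆ x)
  ... | no  y≢x  = p⊆p∪q ⁅ x ⁆ (x∈p∧x≢y⇒x∈p-y y∈p y≢x)

x∈p─q⇒x∉q : ∀ (p q : Subset n) → x ∈ p ─ q → x ∉ q
x∈p─q⇒x∉q (_ ∷ p) (inside  ∷ q) () here
x∈p─q⇒x∉q (_ ∷ p) (_ ∷ q) (there x∈p─q) (there x∈q) = x∈p─q⇒x∉q p q x∈p─q x∈q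

x∈p-y⁻ : ∀ (p : Subset n) y → x ∈ p - y → x ∈ p × x ≢ y
x∈p-y⁻ p y x∈p-y = p─q⊆p p ⁅ y ⁆ x∈p-y , λ { refl → x∈p─q⇒x∉q p ⁅ y ⁆ x∈p-y (x∈⁅x⁆ y) }

p⊆⁅x⁆⇒∣p∣≤1 : ∀ x → p ⊆ ⁅ x ⁆ → ∣ p ∣ ≤ 1
p⊆⁅x⁆⇒∣p∣≤1 x p⊆⁅x⁆ = ≤-trans (p⊆q⇒∣p∣≤∣q∣ p⊆⁅x⁆) (≤-reflexive (∣⁅x⁆∣≡1 x))

p⊆⁅x⁆∪⁅y⁆⇒∣p∣≤2 : ∀ x y → p ⊆ ⁅ x ⁆ ∪ ⁅ y ⁆ → ∣ p ∣ ≤ 2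
p⊆⁅x⁆∪⁅y⁆⇒∣p∣≤2 x y p⊆ = ≤-trans (p⊆q⇒∣p∣≤∣q∣ p⊆)
  (≤-trans (∣p∪⁅x⁆∣≤1+∣p∣ ⁅ x ⁆ y) (s≤s (≤-reflexive (∣⁅x⁆∣≡1 x))))

Empty⇒∣p∣≤ : Empty p → ∣ p ∣ ≤ k
Empty⇒∣p∣≤ {n} ∅ rewrite Empty-unique ∅ | ∣⊥∣≡0 n = z≤n

subsingleton⇒∣p∣≤1 : (∀ {x y} → x ∈ p → y ∈ p → x ≡ y) → ∣ p ∣ ≤ 1
subsingleton⇒∣p∣≤1 {p = p} unique with nonempty? p
... | no  p≡∅       = Empty⇒∣p∣≤ p≡∅
... | yes (x , x∈p) = p⊆⁅x⁆⇒∣p∣≤1 x λ y∈p → subst (_∈ ⁅ x ⁆) (unique x∈p y∈p) (x∈⁅x⁆ x)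

∣p∣≥1 : x ∈ p → 1 ≤ ∣ p ∣
∣p∣≥1 {x = x} {p = p} x∈p = ≤-trans (≤-reflexive (sym (∣⁅x⁆∣≡1 x)))
  (p⊆q⇒∣p∣≤∣q∣ λ y∈ → subst (_∈ p) (sym (x∈⁅y⁆⇒x≡y x y∈)) x∈p)

∣p∣≤1⇒≡ : ∣ p ∣ ≤ 1 → x ∈ p → y ∈ p → x ≡ y
∣p∣≤1⇒≡ {p = p} {x = x} {y = y} ∣p∣≤1 x∈p y∈p with x Fin.≟ y
... | yes x≡y = x≡y
... | no  x≢y = contradiction ∣p∣≤1 (<⇒≱
  (<-≤-trans (s≤s (∣p∣≥1 (x∈p∧x≢y⇒x∈p-y x∈p x≢y))) (x∈p⇒∣p-x∣<∣p∣ y∈p)))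

∣p∣≤2⇒≡ : ∣ p ∣ ≤ 2 → x ∈ p → y ∈ p → z ∈ p → x ≢ z → y ≢ z → x ≡ y
∣p∣≤2⇒≡ ∣p∣≤2 x∈p y∈p z∈p x≢z y≢z = ∣p∣≤1⇒≡
  (≤-pred (≤-trans (x∈p⇒∣p-x∣<∣p∣ z∈p) ∣p∣≤2))
  (x∈p∧x≢y⇒x∈p-y x∈p x≢z) (x∈p∧x≢y⇒x∈p-y y∈p y≢z)

∣p∣≰1⇒∃≢ : ¬ ∣ p ∣ ≤ 1 → ∀ x → ∃[ y ] y ∈ p × y ≢ x
∣p∣≰1⇒∃≢ {p = p} ∣p∣≰1 x with Fin.any? (λ y → (y ∈? p) ×-dec ¬? (y Fin.≟ x))
... | yes ∃y = ∃y
... | no ¬∃y = contradiction (p⊆⁅x⁆⇒∣p∣≤1 x λ {y} y∈p →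
  subst (_∈ ⁅ x ⁆) (sym (decidable-stable (y Fin.≟ x) λ y≢x → ¬∃y (y , y∈p , y≢x))) (x∈⁅x⁆ x))
  ∣p∣≰1

-- Induction on `k`: `f zero` is removed from `p`, and injectivity keeps the remaining values in
-- what is left.
injection⇒≤∣p∣ : (f : Fin k → Fin n) → (∀ {i j} → f i ≡ f j → i ≡ j) →
                 (∀ i → f i ∈ p) → k ≤ ∣ p ∣
injection⇒≤∣p∣ {zero}  f f-inj f∈p = z≤n
injection⇒≤∣p∣ {suc k} f f-inj f∈p = ≤-trans
  (s≤s (injection⇒≤∣p∣ (f ∘ suc) (Fin.suc-injective ∘ f-inj)
    λ i → x∈p∧x≢y⇒x∈p-y (f∈p (suc i)) (λ fᵢ≡f₀ → Fin.0≢1+n (sym (f-inj fᵢ≡f₀)))))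
  (x∈p⇒∣p-x∣<∣p∣ (f∈p zero))

-- After `f zero` is removed, the other sets still cover the rest of `p`, and their intersections
-- with it only shrink. The bound concerns `f i ∩ p` because closed neighbourhoods are small only
-- inside a packing.
cover⇒∣p∣≤ : ∀ p (f : Fin k → Subset n) → (∀ i → ∣ f i ∩ p ∣ ≤ l) →
             (∀ {x} → x ∈ p → ∃[ i ] x ∈ f i) → ∣ p ∣ ≤ k * l
cover⇒∣p∣≤ {zero}  p f ∣f∩p∣≤ cover = Empty⇒∣p∣≤ λ (x , x∈p) → Fin.¬Fin0 (proj₁ (cover x∈p))
cover⇒∣p∣≤ {suc k} {l = l} p f ∣f∩p∣≤ cover = ≤-trans
  (p⊆q∪r⇒∣p∣≤∣q∣+∣r∣ (f zero ∩ p) (p ─ f zero) split)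
  (+-mono-≤ (∣f∩p∣≤ zero) (cover⇒∣p∣≤ (p ─ f zero) (f ∘ suc)
    (λ i → ≤-trans (p⊆q⇒∣p∣≤∣q∣ (shrink i)) (∣f∩p∣≤ (suc i))) cover′))
  where
  split : p ⊆ (f zero ∩ p) ∪ (p ─ f zero)
  split {x} x∈p with x ∈? f zero
  ... | yes x∈f = p⊆p∪q _ (x∈p∩q⁺ (x∈f , x∈p))
  ... | no  x∉f = q⊆p∪q (f zero ∩ p) _ (x∈p∧x∉q⇒x∈p─q x∈p x∉f)
  shrink : ∀ i → f (suc i) ∩ (p ─ f zero) ⊆ f (suc i) ∩ p
  shrink i x∈ with x∈p∩q⁻ _ _ x∈
  ... | x∈f , x∈p─ = x∈p∩q⁺ (x∈f , p─q⊆p p (f zero) x∈p─)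
  cover′ : ∀ {x} → x ∈ p ─ f zero → ∃[ i ] x ∈ f (suc i)
  cover′ x∈ with cover (p─q⊆p p (f zero) x∈)
  ... | zero  , x∈f = contradiction x∈f (x∈p─q⇒x∉q p (f zero) x∈)
  ... | suc i , x∈f = i , x∈f

-- Enumeration and comprehension of subsets.

-- Vertices of `G ⟨ S ⟩` carry a membership proof; this makes them equal as soon as the underlying
-- vertices are.
∈-irrelevant : (s t : x ∈ p) → s ≡ t
∈-irrelevant here      here      = refl
∈-irrelevant (there s) (there t) = cong there (∈-irrelevant s t)

-- Lists `p` in increasing order; it will number the copies of K₂.
elem : (p : Subset n) → Fin ∣ p ∣ → Fin n
elem (outside ∷ p) i       = suc (elem p i)
elem (inside  ∷ p) zero    = zero
elem (inside  ∷ p) (suc i) = suc (elem p i)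

elem∈ : ∀ (p : Subset n) i → elem p i ∈ p
elem∈ (outside ∷ p) i       = there (elem∈ p i)
elem∈ (inside  ∷ p) zero    = here
elem∈ (inside  ∷ p) (suc i) = there (elem∈ p i)

elem-injective : ∀ (p : Subset n) {i j} → elem p i ≡ elem p j → i ≡ j
elem-injective (outside ∷ p)                 eq = elem-injective p (Fin.suc-injective eq)
elem-injective (inside  ∷ p) {zero}  {zero}  eq = refl
elem-injective (inside  ∷ p) {suc i} {suc j} eq =
  cong suc (elem-injective p (Fin.suc-injective eq))

elem-surjective : ∀ (p : Subset n) → x ∈ p → ∃[ i ] elem p i ≡ x
elem-surjective (inside  ∷ p) here       = zero , refl
elem-surjective (outside ∷ p) (there x∈) with elem-surjective p x∈
... | i , eq = i , cong suc eq
elem-surjective (inside  ∷ p) (there x∈) with elem-surjective p x∈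
... | i , eq = suc i , cong suc eq

module _ {P : Pred (Fin n) 0ℓ} (P? : Decidable P) where

  -- `N G v` unfolds to the case `P? = adj? G v`, so the two membership lemmas below also serve for
  -- neighbourhoods.
  comprehension : Subset n
  comprehension = tabulate (does ∘ P?)

  ∈-comprehension⁺ : P x → x ∈ comprehension
  ∈-comprehension⁺ {x} Px = lookup⇒[]= x _ (trans (lookup∘tabulate _ x) (dec-true (P? x) Px))

  ∈-comprehension⁻ : x ∈ comprehension → P x
  ∈-comprehension⁻ {x} x∈ with P? x | trans (sym (lookup∘tabulate (does ∘ P?) x)) ([]=⇒lookup x∈)
  ... | yes Px | _  = Px
  ... | no  _  | ()

opposite-≢ : ∀ (i : Fin 2) → opposite i ≢ i
opposite-≢ zero       ()
opposite-≢ (suc zero) ()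

≢⇒opposite : ∀ {i j : Fin 2} → i ≢ j → j ≡ opposite i
≢⇒opposite {zero}     {zero}     i≢j = contradiction refl i≢j
≢⇒opposite {zero}     {suc zero} i≢j = refl
≢⇒opposite {suc zero} {zero}     i≢j = refl
≢⇒opposite {suc zero} {suc zero} i≢j = contradiction refl i≢j

-- Initial segments of lists, for closing paths into cycles.

upto : {A : Set} {w : A} {zs : List A} → w ∈ˡ zs → List A
upto {zs = z ∷ _} (here _)  = [ z ]
upto {zs = z ∷ _} (there i) = z ∷ upto i

upto-nonempty : {A : Set} {w : A} {zs : List A} (i : w ∈ˡ zs) → 1 ≤ length (upto i)
upto-nonempty (here _)  = s≤s z≤n
upto-nonempty (there _) = s≤s z≤n

upto-All : {A : Set} {P : Pred A 0ℓ} {w : A} {zs : List A} (i : w ∈ˡ zs) →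
           All P zs → All P (upto i)
upto-All (here _)  (pz ∷ _)   = pz ∷ []
upto-All (there i) (pz ∷ pzs) = pz ∷ upto-All i pzs

upto-Unique : {A : Set} {w : A} {zs : List A} (i : w ∈ˡ zs) → Unique zs → Unique (upto i)
upto-Unique (here _)  (_ ∷ _)    = [] ∷ []
upto-Unique (there i) (z∉ ∷ zs!) = upto-All i z∉ ∷ upto-Unique i zs!

-- Closes the segment ending in `w` by a step to `s`. The induction moves `t` along the list and
-- keeps `s`; started with `s = t`, it gives a closed walk.
upto-Linked : {A : Set} {R : A → A → Set} {w s t : A} {zs : List A} (i : w ∈ˡ zs) →
              Linked R (t ∷ zs) → R w s → Linked R (t ∷ (upto i ∷ʳ s))
upto-Linked (here refl) (Rtw ∷ _)   Rws = Rtw ∷ Rws ∷ [-]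
upto-Linked (there i)   (Rtz ∷ Rzs) Rws = Rtz ∷ upto-Linked i Rzs Rws

-- Neighbourhoods and packings.

module Graph {n} (G : SimpleGraph (Fin n)) where

  open DecMembership (Fin._≟_ {n}) using () renaming (_∈?_ to _∈ˡ?_)

  infix 4 _~_

  _~_ : Fin n → Fin n → Set
  _~_ = Adj G

  ~-sym : ∀ {u v} → u ~ v → v ~ u
  ~-sym = symm G

  ~⇒≢ : ∀ {u v} → u ~ v → u ≢ v
  ~⇒≢ u~v u≡v = irrefl G u≡v u~v

  ∈-N⁺ : ∀ {u v} → v ~ u → u ∈ N G v
  ∈-N⁺ {v = v} = ∈-comprehension⁺ (adj? G v)

  ∈-N⁻ : ∀ {u v} → u ∈ N G v → v ~ u
  ∈-N⁻ {v = v} = ∈-comprehension⁻ (adj? G v)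

  ∈-N[]⁺ : ∀ {u v} → u ≡ v ⊎ v ~ u → u ∈ N[ G , v ]
  ∈-N[]⁺ {v = v} (inj₁ refl) = p⊆p∪q (N G v) (x∈⁅x⁆ v)
  ∈-N[]⁺ {v = v} (inj₂ v~u)  = q⊆p∪q ⁅ v ⁆ (N G v) (∈-N⁺ v~u)

  ∈-N[]⁻ : ∀ {u v} → u ∈ N[ G , v ] → u ≡ v ⊎ v ~ u
  ∈-N[]⁻ {v = v} u∈ with x∈p∪q⁻ ⁅ v ⁆ (N G v) u∈
  ... | inj₁ u∈⁅v⁆ = inj₁ (x∈⁅y⁆⇒x≡y v u∈⁅v⁆)
  ... | inj₂ u∈N   = inj₂ (∈-N⁻ u∈N)

  ∈-N∩⁻ : ∀ {u v S} → u ∈ N G v ∩ S → v ~ u × u ∈ S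
  ∈-N∩⁻ {v = v} {S} u∈ with x∈p∩q⁻ (N G v) S u∈
  ... | u∈N , u∈S = ∈-N⁻ u∈N , u∈S

  ∈-N[]∩⁻ : ∀ {u v S} → u ∈ N[ G , v ] ∩ S → (u ≡ v ⊎ v ~ u) × u ∈ S
  ∈-N[]∩⁻ {v = v} {S} u∈ with x∈p∩q⁻ N[ G , v ] S u∈
  ... | u∈N , u∈S = ∈-N[]⁻ u∈N , u∈S

  -- `OpenPacking` without counting, as used to identify two vertices that share a neighbour.
  AtMostOneNeighbourIn : Subset n → Set
  AtMostOneNeighbourIn S = ∀ {v x y} → v ~ x → v ~ y → x ∈ S → y ∈ S → x ≡ y

  openPacking⁻ : OpenPacking G S → AtMostOneNeighbourIn S
  openPacking⁻ packing {v} v~x v~y x∈S y∈S = ∣p∣≤1⇒≡ (packing v)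
    (x∈p∩q⁺ (∈-N⁺ v~x , x∈S)) (x∈p∩q⁺ (∈-N⁺ v~y , y∈S))

  openPacking⁺ : AtMostOneNeighbourIn S → OpenPacking G S
  openPacking⁺ {S} unique v = subsingleton⇒∣p∣≤1 λ x∈ y∈ →
    let v~x , x∈S = ∈-N∩⁻ {S = S} x∈
        v~y , y∈S = ∈-N∩⁻ {S = S} y∈
    in unique v~x v~y x∈S y∈S

  ∅-openPacking : OpenPacking G ⊥
  ∅-openPacking = openPacking⁺ λ _ _ x∈⊥ → contradiction x∈⊥ ∉⊥

  ∣S∣≤ρ⁰ : OpenPacking G S → ∣ S ∣ ≤ ρ⁰ G
  ∣S∣≤ρ⁰ = ∣S∣≤maxCard (openPacking? G)

  ∣B∣≤L₂ : TwoLimitedPacking G S → ∣ S ∣ ≤ L₂ G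
  ∣B∣≤L₂ = ∣S∣≤maxCard (twoLimitedPacking? G)

  -- Passing from the open to the closed neighbourhood adds only `v`, so a bound of 1 becomes 2.
  openPacking⇒twoLimited : OpenPacking G S → TwoLimitedPacking G S
  openPacking⇒twoLimited {S} packing v = ≤-trans
    (p⊆q⇒∣p∣≤∣q∣ N[v]∩S⊆)
    (≤-trans (∣p∪⁅x⁆∣≤1+∣p∣ (N G v ∩ S) v) (s≤s (packing v)))
    where
    N[v]∩S⊆ : N[ G , v ] ∩ S ⊆ (N G v ∩ S) ∪ ⁅ v ⁆
    N[v]∩S⊆ x∈ with ∈-N[]∩⁻ {S = S} x∈
    ... | inj₁ refl , _   = q⊆p∪q (N G v ∩ S) ⁅ v ⁆ (x∈⁅x⁆ v)
    ... | inj₂ v~x  , x∈S = p⊆p∪q ⁅ v ⁆ (x∈p∩q⁺ (∈-N⁺ v~x , x∈S))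

  maximumOpenPacking : ∃[ S ] OpenPacking G S × ∣ S ∣ ≡ ρ⁰ G
  maximumOpenPacking = maxCard-attained (openPacking? G) ∅-openPacking

  maximumTwoLimitedPacking : ∃[ B ] TwoLimitedPacking G B × ∣ B ∣ ≡ L₂ G
  maximumTwoLimitedPacking =
    maxCard-attained (twoLimitedPacking? G) (openPacking⇒twoLimited ∅-openPacking)

  ρ⁰≤L₂ : ρ⁰ G ≤ L₂ G
  ρ⁰≤L₂ with S , packing , ∣S∣≡ρ⁰ ← maximumOpenPacking =
    subst (_≤ L₂ G) ∣S∣≡ρ⁰ (∣B∣≤L₂ (openPacking⇒twoLimited packing))

  -- Paths and leaves in acyclic graphs.

  -- The newest vertex `x` stands first. If `w` lay on the path beyond `y`, the segment from `x` to
  -- `w` and the edge back to `x` would form a cycle.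
  extendPath : ¬ Cycle G → ∀ {x y zs} → Linked _~_ (x ∷ y ∷ zs) → Unique (x ∷ y ∷ zs) →
               ∀ {w} → x ~ w → w ≢ y → All (w ≢_) (x ∷ y ∷ zs)
  extendPath acyclic {x} {y} {zs} path path! {w} x~w w≢y
    with w ∈ˡ? x ∷ y ∷ zs
  ... | no  w∉                 = All.¬Any⇒All¬ _ w∉
  ... | yes (here w≡x)         = contradiction (sym w≡x) (~⇒≢ x~w)
  ... | yes (there (here w≡y)) = contradiction w≡y w≢y
  ... | yes (there (there w∈)) = contradiction cycle acyclic
    where
    cycle : Cycle G
    cycle = record
      { start    = x
      ; rest     = upto {zs = y ∷ zs} (there w∈)
      ; long     = s≤s (upto-nonempty w∈)
      ; distinct = upto-Unique {zs = x ∷ y ∷ zs} (there (there w∈)) path!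
      ; closed   = upto-Linked {zs = y ∷ zs} (there w∈) path (~-sym x~w)
      }

  -- Otherwise a path in A could be extended forever.
  leafIn : ¬ Cycle G → ∀ A → Nonempty A → ∃[ v ] v ∈ A × ∣ N G v ∩ A ∣ ≤ 1
  leafIn acyclic A (x , x∈A) with Fin.any? (λ v → (v ∈? A) ×-dec (∣ N G v ∩ A ∣ ≤? 1))
  ... | yes leaf = leaf
  ... | no ¬leaf = ⊥-elim (grow₁ x∈A)
    where
    next : ∀ {v} → v ∈ A → ∀ y → ∃[ w ] (v ~ w × w ∈ A) × w ≢ y
    next {v} v∈A y with ∣p∣≰1⇒∃≢ (λ ∣N∩A∣≤1 → ¬leaf (v , v∈A , ∣N∩A∣≤1)) y
    ... | w , w∈ , w≢y = w , ∈-N∩⁻ {S = A} w∈ , w≢y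

    -- Vertices of `A` missing from the path lie in `U`, which loses `w` at each step; this makes
    -- the recursion well-founded.
    grow : ∀ {U} → Acc _⊂_ U → ∀ {x y zs} → Linked _~_ (x ∷ y ∷ zs) →
           Unique (x ∷ y ∷ zs) → x ∈ A →
           (∀ {v} → v ∈ A → v ∉ U → v ∈ˡ x ∷ y ∷ zs) → Absurd
    grow {U} (acc rs) {x} {y} {zs} path path! x∈A visited
      with w , (x~w , w∈A) , w≢y ← next x∈A y
      with w∉path ← extendPath acyclic path path! x~w w≢y
      with w ∈? U
    ... | no  w∉U = contradiction refl (All.lookup w∉path (visited w∈A w∉U))
    ... | yes w∈U = grow (rs (x∈p⇒p-x⊂p w∈U)) (~-sym x~w ∷ path) (w∉path ∷ path!) w∈A visited′
      where
      visited′ : ∀ {v} → v ∈ A → v ∉ U - w → v ∈ˡ w ∷ x ∷ y ∷ zs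
      visited′ {v} v∈A v∉ with v Fin.≟ w
      ... | yes v≡w = here v≡w
      ... | no  v≢w = there (visited v∈A λ v∈U → v∉ (x∈p∧x≢y⇒x∈p-y v∈U v≢w))

    grow₁ : ∀ {x} → x ∈ A → Absurd
    -- There is no earlier vertex to avoid, so `x` fills that place and yields the distinctness of
    -- the first two vertices.
    grow₁ {x} x∈A with y , (x~y , y∈A) , y≢x ← next x∈A x =
      grow (⊂-wellFounded A) (~-sym x~y ∷ [-]) ((y≢x ∷ []) ∷ [] ∷ []) y∈A
        λ v∈A v∉A → contradiction v∈A v∉A

  -- Two-colouring the conflicts in a 2-limited packing.

  -- The middle `m` must lie in `A` too, so that deleting a vertex from `A` removes every conflict
  -- in which it is an end or the middle.
  Separates : Subset n → Subset n → (Fin n → Bool) → Set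
  Separates B A c = ∀ {m x y} → m ∈ A → x ∈ A → y ∈ A → x ∈ B → y ∈ B →
                    m ~ x → m ~ y → x ≢ y → c x ≢ c y

  -- Two vertices of `B` in conflict with `z` through the same `m` coincide, since `N[ G , m ]` has
  -- room for only two.
  twoLimited⁻ : ∀ {B} → TwoLimitedPacking G B → ∀ {m x y z} → x ∈ B → y ∈ B → z ∈ B →
                m ~ x → m ~ y → m ~ z → x ≢ z → y ≢ z → x ≡ y
  twoLimited⁻ {B} limited {m} x∈B y∈B z∈B m~x m~y m~z = ∣p∣≤2⇒≡ (limited m)
    (mem m~x x∈B) (mem m~y y∈B) (mem m~z z∈B)
    where
    mem : ∀ {u} → m ~ u → u ∈ B → u ∈ N[ G , m ] ∩ B
    mem m~u u∈B = x∈p∩q⁺ (∈-N[]⁺ (inj₂ m~u) , u∈B)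

  module _ (acyclic : ¬ Cycle G) {B} (limited : TwoLimitedPacking G B) where

    -- Vertices are coloured in the reverse of a leaf-elimination order. The leaf v
    -- shares its only neighbour with at most one other vertex of B, and gets the
    -- opposite colour.
    colouring : ∀ {A} → Acc _⊂_ A → ∃[ c ] Separates B A c
    colouring {A} (acc rs) with nonempty? A
    ... | no A≡∅ = (λ _ → true) , λ {m} m∈A → contradiction (m , m∈A) A≡∅
    ... | yes A≢∅
      with v , v∈A , leaf ← leafIn acyclic A A≢∅
      with c′ , sep′ ← colouring (rs (x∈p⇒p-x⊂p v∈A)) = c , sep
      where
      A′ : Subset n
      A′ = A - v

      Rival : Fin n → Set
      Rival w = w ∈ A′ × w ∈ B × ∃[ m ] m ∈ A × m ~ v × m ~ w

      rival? : Dec (∃[ w ] Rival w)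
      rival? = Fin.any? λ w → (w ∈? A′) ×-dec (w ∈? B) ×-dec
        Fin.any? λ m → (m ∈? A) ×-dec adj? G m v ×-dec adj? G m w

      colour : Dec (∃[ w ] Rival w) → Bool
      colour (yes (w , _)) = not (c′ w)
      -- Without a rival either colour would do.
      colour (no _)        = true

      c : Fin n → Bool
      c = updateAt c′ v λ _ → colour rival?

      leaf-unique : ∀ {x y} → v ~ x → v ~ y → x ∈ A → y ∈ A → x ≡ y
      leaf-unique v~x v~y x∈A y∈A = ∣p∣≤1⇒≡ leaf
        (x∈p∩q⁺ (∈-N⁺ v~x , x∈A)) (x∈p∩q⁺ (∈-N⁺ v~y , y∈A))

      colour-≢ : ∀ r {m y} → m ∈ A → y ∈ A′ → v ∈ B → y ∈ B → m ~ v → m ~ y →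
                 colour r ≢ c′ y
      colour-≢ (no ¬r) m∈A y∈A′ v∈B y∈B m~v m~y =
        contradiction (_ , y∈A′ , y∈B , _ , m∈A , m~v , m~y) ¬r
      colour-≢ (yes (w , w∈A′ , w∈B , m′ , m′∈A , m′~v , m′~w)) m∈A y∈A′ v∈B y∈B m~v m~y
        -- Both conflicts of the leaf `v` pass through its only neighbour in `A`, and 2-limitedness
        -- there forces `w` and `y` to be equal.
        with refl ← leaf-unique (~-sym m′~v) (~-sym m~v) m′∈A m∈A
        with refl ← twoLimited⁻ limited w∈B y∈B v∈B m′~w m~y m~v
                      (proj₂ (x∈p-y⁻ A v w∈A′)) (proj₂ (x∈p-y⁻ A v y∈A′)) =
        ≢-sym (Bool.not-¬ refl)

      v-sep : ∀ {m y} → m ∈ A → y ∈ A → v ∈ B → y ∈ B → m ~ v → m ~ y → y ≢ v → c v ≢ c y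
      v-sep {y = y} m∈A y∈A v∈B y∈B m~v m~y y≢v
        rewrite updateAt-updates v {λ _ → colour rival?} c′
              | updateAt-minimal y v {λ _ → colour rival?} c′ y≢v =
        colour-≢ rival? m∈A (x∈p∧x≢y⇒x∈p-y y∈A y≢v) v∈B y∈B m~v m~y

      sep : Separates B A c
      sep {m} {x} {y} m∈A x∈A y∈A x∈B y∈B m~x m~y x≢y with x Fin.≟ v | y Fin.≟ v
      ... | yes refl | _        = v-sep m∈A y∈A x∈B y∈B m~x m~y (≢-sym x≢y)
      ... | no  _    | yes refl = ≢-sym (v-sep m∈A x∈A y∈B x∈B m~y m~x x≢y)
      ... | no x≢v   | no y≢v
        rewrite updateAt-minimal x v {λ _ → colour rival?} c′ x≢v
              | updateAt-minimal y v {λ _ → colour rival?} c′ y≢v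
        -- `sep′` covers only middles in `A′`; if the middle is `v`, then `x` and `y` are both its
        -- only neighbour in `A`.
        with m Fin.≟ v
      ...   | yes refl = contradiction (leaf-unique m~x m~y x∈A y∈A) x≢y
      ...   | no  m≢v  = sep′ (x∈p∧x≢y⇒x∈p-y m∈A m≢v) (x∈p∧x≢y⇒x∈p-y x∈A x≢v)
        (x∈p∧x≢y⇒x∈p-y y∈A y≢v) x∈B y∈B m~x m~y x≢y

    ∣B∣≤2ρ⁰ : ∣ B ∣ ≤ 2 * ρ⁰ G
    -- For `A = ⊤` the colouring separates every conflict in `B`.
    ∣B∣≤2ρ⁰ with c , sep ← colouring (⊂-wellFounded ⊤) = begin
      ∣ B ∣                             ≤⟨ p⊆q∪r⇒∣p∣≤∣q∣+∣r∣ (class true) (class false) split ⟩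
      ∣ class true ∣ + ∣ class false ∣  ≤⟨ +-mono-≤ (∣class∣≤ true) (∣class∣≤ false) ⟩
      ρ⁰ G + ρ⁰ G                       ≡⟨ cong (ρ⁰ G +_) (+-identityʳ (ρ⁰ G)) ⟨
      2 * ρ⁰ G                          ∎
      where
      open ≤-Reasoning
      class? : ∀ b → Decidable (λ x → x ∈ B × c x ≡ b)
      class? b x = (x ∈? B) ×-dec (c x Bool.≟ b)

      class : Bool → Subset n
      class b = comprehension (class? b)

      split : B ⊆ class true ∪ class false
      split {x} x∈B with c x in cx
      ... | true  = p⊆p∪q (class false) (∈-comprehension⁺ (class? true) (x∈B , cx))
      ... | false = q⊆p∪q (class true) _ (∈-comprehension⁺ (class? false) (x∈B , cx))

      ∣class∣≤ : ∀ b → ∣ class b ∣ ≤ ρ⁰ G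
      ∣class∣≤ b = ∣S∣≤ρ⁰ (openPacking⁺ λ {v} {x} {y} v~x v~y x∈ y∈ →
        let x∈B , cx≡b = ∈-comprehension⁻ (class? b) x∈
            y∈B , cy≡b = ∈-comprehension⁻ (class? b) y∈
        in decidable-stable (x Fin.≟ y) λ x≢y →
          sep ∈⊤ ∈⊤ ∈⊤ x∈B y∈B v~x v~y x≢y (trans cx≡b (sym cy≡b)))

  L₂≤2ρ⁰ : ¬ Cycle G → L₂ G ≤ 2 * ρ⁰ G
  L₂≤2ρ⁰ acyclic with B , limited , ∣B∣≡L₂ ← maximumTwoLimitedPacking =
    subst (_≤ 2 * ρ⁰ G) ∣B∣≡L₂ (∣B∣≤2ρ⁰ acyclic limited)

  -- Forbidden short cycles.

  triangle-free : ¬ Cycle G → ∀ {a b c} → a ~ b → b ~ c → ¬ c ~ a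
  triangle-free acyclic {a} {b} {c} a~b b~c c~a = acyclic record
    { start    = a
    ; rest     = b ∷ c ∷ []
    ; long     = s≤s (s≤s z≤n)
    ; distinct = (~⇒≢ a~b ∷ ≢-sym (~⇒≢ c~a) ∷ []) ∷ (~⇒≢ b~c ∷ []) ∷ [] ∷ []
    ; closed   = a~b ∷ b~c ∷ c~a ∷ [-]
    }

  -- Distinctness is assumed for the diagonals alone; adjacent vertices differ by irreflexivity.
  C₄-free : ¬ Cycle G → ∀ {a b c d} → a ≢ c → b ≢ d → a ~ b → b ~ c → c ~ d → ¬ d ~ a
  C₄-free acyclic {a} {b} {c} {d} a≢c b≢d a~b b~c c~d d~a = acyclic record
    { start    = a
    ; rest     = b ∷ c ∷ d ∷ []
    ; long     = s≤s (s≤s z≤n)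
    ; distinct = (~⇒≢ a~b ∷ a≢c ∷ ≢-sym (~⇒≢ d~a) ∷ []) ∷ (~⇒≢ b~c ∷ b≢d ∷ []) ∷
                 (~⇒≢ c~d ∷ []) ∷ [] ∷ []
    ; closed   = a~b ∷ b~c ∷ c~d ∷ d~a ∷ [-]
    }

  C₅-free : ¬ Cycle G → ∀ {a b c d e} → a ≢ c → a ≢ d → b ≢ d → b ≢ e → c ≢ e →
            a ~ b → b ~ c → c ~ d → d ~ e → ¬ e ~ a
  C₅-free acyclic {a} {b} {c} {d} {e} a≢c a≢d b≢d b≢e c≢e a~b b~c c~d d~e e~a = acyclic record
    { start    = a
    ; rest     = b ∷ c ∷ d ∷ e ∷ []
    ; long     = s≤s (s≤s z≤n)
    ; distinct = (~⇒≢ a~b ∷ a≢c ∷ a≢d ∷ ≢-sym (~⇒≢ e~a) ∷ []) ∷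
                 (~⇒≢ b~c ∷ b≢d ∷ b≢e ∷ []) ∷ (~⇒≢ c~d ∷ c≢e ∷ []) ∷
                 (~⇒≢ d~e ∷ []) ∷ [] ∷ []
    ; closed   = a~b ∷ b~c ∷ c~d ∷ d~e ∷ e~a ∷ [-]
    }

  -- Equality for trees in 𝒯.

  module _ (G∈𝒯 : G ∈𝒯) where

    open _∈𝒯 G∈𝒯
    open _≅_ iso using (to; from; preserves; bijection)

    private
      vertex : Fin a × Fin 2 → Fin n
      vertex = proj₁ ∘ from

      vertex~ : ∀ i k → vertex (i , k) ~ vertex (i , opposite k)
      vertex~ i k = Equivalence.from (preserves _ _)
        (subst₂ (Adj (a · K 2)) (sym (Inverse.strictlyInverseˡ bijection (i , k)))
          (sym (Inverse.strictlyInverseˡ bijection (i , opposite k)))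
          (refl , ≢-sym (opposite-≢ k)))

      vertex~⁻ : ∀ {i k t} → vertex (i , k) ~ vertex t → t ≡ (i , opposite k)
      vertex~⁻ {i} {k} {t} s~t
        with refl , k≢l ← subst₂ (Adj (a · K 2)) (Inverse.strictlyInverseˡ bijection (i , k))
               (Inverse.strictlyInverseˡ bijection t)
               (Equivalence.to (preserves (from (i , k)) (from t)) s~t)
        = cong (i ,_) (≢⇒opposite k≢l)

      vertex-injective : ∀ {s t} → vertex s ≡ vertex t → s ≡ t
      vertex-injective eq = Injection.injective (↔⇒↣ (↔-sym bijection)) (Σ-≡ eq)
        where
        Σ-≡ : ∀ {u v : Σ[ x ∈ Fin n ] x ∈ S₀} → proj₁ u ≡ proj₁ v → u ≡ v
        Σ-≡ {u , u∈} {_ , v∈} refl = cong (u ,_) (∈-irrelevant u∈ v∈)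

      position : ∀ {v} → v ∈ S₀ → ∃[ s ] vertex s ≡ v
      position v∈ = to (_ , v∈) , cong proj₁ (Inverse.strictlyInverseʳ bijection (_ , v∈))

      S₀⊎R₀ : ∀ v → v ∈ S₀ ⊎ v ∈ R₀
      S₀⊎R₀ v = x∈p∪q⁻ S₀ R₀ (subst (v ∈_) (sym covering) ∈⊤)

      -- For `v` in `R₀` this is condition (ii). A vertex of `S₀` has only the other end of its copy
      -- as neighbour in `S₀`, because the copies form the induced subgraph.
      atMostOneNeighbourInS₀ : AtMostOneNeighbourIn S₀
      atMostOneNeighbourInS₀ {v} v~x v~y x∈ y∈ with S₀⊎R₀ v
      ... | inj₂ v∈R₀ = ∣p∣≤1⇒≡ (≤-reflexive (oneNeighbour v∈R₀))
        (x∈p∩q⁺ (∈-N⁺ v~x , x∈)) (x∈p∩q⁺ (∈-N⁺ v~y , y∈))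
      ... | inj₁ v∈S₀
        with (i , k) , refl ← position v∈S₀
        with s , refl ← position x∈
        with t , refl ← position y∈ =
        cong vertex (trans (vertex~⁻ {t = s} v~x) (sym (vertex~⁻ {t = t} v~y)))

      -- `S₀` is an open packing, and `Fin (a * 2)`, read as `Fin a × Fin 2`, injects into it.
      a*2≤ρ⁰ : a * 2 ≤ ρ⁰ G
      a*2≤ρ⁰ = ≤-trans
        (injection⇒≤∣p∣ (vertex ∘ Inverse.to Fin.*↔×)
          (λ eq → Injection.injective (↔⇒↣ Fin.*↔×) (vertex-injective eq))
          (λ i → proj₂ (from (Inverse.to Fin.*↔× i))))
        (∣S∣≤ρ⁰ (openPacking⁺ atMostOneNeighbourInS₀))

      leafEnd centreEnd : Fin a → Fin 2
      leafEnd i   = proj₁ (leafInCopy i)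
      centreEnd i = opposite (leafEnd i)

      leaf centre : Fin a → Fin n
      leaf i   = vertex (i , leafEnd i)
      centre i = vertex (i , centreEnd i)

      neighbour-of-leaf : ∀ {i v} → leaf i ~ v → v ≡ centre i
      neighbour-of-leaf {i} leaf~v = ∣p∣≤1⇒≡ (≤-reflexive (proj₂ (leafInCopy i)))
        (∈-N⁺ leaf~v) (∈-N⁺ (vertex~ i (leafEnd i)))

      -- A vertex of `S₀` is the centre of its copy or the leaf next to it. A vertex of `R₀` has a
      -- neighbour in `S₀`; were this a leaf end, the vertex would be the centre itself, which is
      -- dominated as well.
      centres-dominate : ∀ v → ∃[ i ] v ∈ N[ G , centre i ]
      centres-dominate v with S₀⊎R₀ v
      ... | inj₁ v∈S₀ with (i , k) , refl ← position v∈S₀ with leafEnd i Fin.≟ k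
      ...   | yes refl = i , ∈-N[]⁺ (inj₂ (~-sym (vertex~ i (leafEnd i))))
      ...   | no  l≢k  = i , ∈-N[]⁺ (inj₁ (cong (λ j → vertex (i , j)) (≢⇒opposite l≢k)))
      centres-dominate v | inj₂ v∈R₀
        with nonempty? (N G v ∩ S₀)
      ... | no ∅ = contradiction
        (≤-trans (≤-reflexive (sym (oneNeighbour v∈R₀))) (Empty⇒∣p∣≤ {k = 0} ∅)) λ()
      ... | yes (u , u∈)
        with v~u , u∈S₀ ← ∈-N∩⁻ {S = S₀} u∈
        with (i , k) , refl ← position u∈S₀
        with leafEnd i Fin.≟ k
      ...   | yes refl = i , ∈-N[]⁺ (inj₁ (neighbour-of-leaf (~-sym v~u)))
      ...   | no  l≢k  = i , ∈-N[]⁺ (inj₂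
        (subst (λ j → vertex (i , j) ~ v) (≢⇒opposite l≢k) (~-sym v~u)))

      -- The closed neighbourhoods of the `a` centres cover all vertices, and each contains at most
      -- two vertices of `B`.
      L₂≤a*2 : L₂ G ≤ a * 2
      L₂≤a*2 with B , limited , ∣B∣≡L₂ ← maximumTwoLimitedPacking =
        subst (_≤ a * 2) ∣B∣≡L₂ (cover⇒∣p∣≤ B (λ i → N[ G , centre i ])
          (λ i → limited (centre i)) (λ {v} _ → centres-dominate v))

    𝒯⇒ρ⁰≡L₂ : ρ⁰ G ≡ L₂ G
    𝒯⇒ρ⁰≡L₂ = ≤-antisym ρ⁰≤L₂ (≤-trans L₂≤a*2 a*2≤ρ⁰)

  -- Perfect matchings induced by open packings.

  module InducedMatching {S a} (unique : AtMostOneNeighbourIn S)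
    (vertex : Fin a × Fin 2 → Fin n)
    (vertex∈S : ∀ s → vertex s ∈ S)
    (vertex-injective : ∀ {s t} → vertex s ≡ vertex t → s ≡ t)
    (vertex-surjective : ∀ {v} → v ∈ S → ∃[ s ] vertex s ≡ v)
    (vertex~ : ∀ i k → vertex (i , k) ~ vertex (i , opposite k))
    where

    private
      to : Σ[ v ∈ Fin n ] v ∈ S → Fin a × Fin 2
      to (v , v∈S) = proj₁ (vertex-surjective v∈S)

      from : Fin a × Fin 2 → Σ[ v ∈ Fin n ] v ∈ S
      from s = vertex s , vertex∈S s

      vertex∘to : ∀ v → vertex (to v) ≡ proj₁ v
      vertex∘to (v , v∈S) = proj₂ (vertex-surjective v∈S)

      from∘to : ∀ v → from (to v) ≡ v
      from∘to (v , v∈S) with s , refl ← vertex-surjective v∈S =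
        cong (v ,_) (∈-irrelevant (vertex∈S s) v∈S)

      -- The opposite end is already a neighbour in `S`, so uniqueness rules out edges between
      -- different pairs.
      ~⇒Adj : ∀ s t → vertex s ~ vertex t → Adj (a · K 2) s t
      ~⇒Adj (i , k) t s~t
        with refl ← vertex-injective {t = t}
          (unique (vertex~ i k) s~t (vertex∈S (i , opposite k)) (vertex∈S t)) =
        refl , ≢-sym (opposite-≢ k)

      Adj⇒~ : ∀ s t → Adj (a · K 2) s t → vertex s ~ vertex t
      Adj⇒~ (i , k) (i , l) (refl , k≢l) with refl ← ≢⇒opposite k≢l = vertex~ i k

    iso : G ⟨ S ⟩ ≅ a · K 2
    iso = record
      { bijection = mk↔ₛ′ to from (λ s → vertex-injective (vertex∘to (from s))) from∘to
      ; preserves = λ u v → mk⇔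
          (λ u~v → ~⇒Adj (to u) (to v) (subst₂ _~_ (sym (vertex∘to u)) (sym (vertex∘to v)) u~v))
          (λ adj → subst₂ _~_ (vertex∘to u) (vertex∘to v) (Adj⇒~ (to u) (to v) adj))
      }

  module PerfectlyMatched {S} (unique : AtMostOneNeighbourIn S)
    (mate : ∀ {v} → v ∈ S → ∃[ u ] u ∈ S × v ~ u)
    where

    private
      -- Each matching edge is represented once, by its smaller end in the order of `Fin n`.
      LowerEnd : Fin n → Set
      LowerEnd v = v ∈ S × ∃[ u ] u ∈ S × v ~ u × v Fin.< u

      lowerEnd? : Decidable LowerEnd
      lowerEnd? v = (v ∈? S) ×-dec Fin.any? λ u →
        (u ∈? S) ×-dec adj? G v u ×-dec (v Fin.<? u)

      M : Subset n
      M = comprehension lowerEnd?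

      lowerEnd : ∀ i → LowerEnd (elem M i)
      lowerEnd i = ∈-comprehension⁻ lowerEnd? (elem∈ M i)

    a : ℕ
    a = ∣ M ∣

    vertex : Fin a × Fin 2 → Fin n
    vertex (i , zero)     = elem M i
    vertex (i , suc zero) = proj₁ (proj₂ (lowerEnd i))

    vertex∈S : ∀ s → vertex s ∈ S
    vertex∈S (i , zero)     = proj₁ (lowerEnd i)
    vertex∈S (i , suc zero) = let _ , _ , u∈S , _ = lowerEnd i in u∈S

    vertex~ : ∀ i k → vertex (i , k) ~ vertex (i , opposite k)
    vertex~ i zero       = let _ , _ , _ , v~u , _ = lowerEnd i in v~u
    vertex~ i (suc zero) = ~-sym (vertex~ i zero)

    private
      vertex< : ∀ i → vertex (i , zero) Fin.< vertex (i , suc zero)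
      vertex< i = let _ , _ , _ , _ , v<u = lowerEnd i in v<u

      -- The opposite end is the only neighbour in `S`, hence determined by the vertex.
      opposite-≡ : ∀ {i j k l} → vertex (i , k) ≡ vertex (j , l) →
                   vertex (i , opposite k) ≡ vertex (j , opposite l)
      opposite-≡ {i} {j} {k} {l} eq = unique (vertex~ i k)
        (subst (_~ vertex (j , opposite l)) (sym eq) (vertex~ j l))
        (vertex∈S (i , opposite k)) (vertex∈S (j , opposite l))

      -- If they agreed, so would their opposite ends, and the same two vertices would be ordered
      -- both ways.
      lower≢upper : ∀ i j → vertex (i , zero) ≢ vertex (j , suc zero)
      lower≢upper i j eq = Fin.<-asym (vertex< i)
        (subst₂ Fin._<_ (sym (opposite-≡ {k = zero} {l = suc zero} eq)) (sym eq) (vertex< j))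

    vertex-injective : ∀ {s t} → vertex s ≡ vertex t → s ≡ t
    vertex-injective {i , zero}     {j , zero}     eq = cong (_, zero) (elem-injective M eq)
    vertex-injective {i , zero}     {j , suc zero} eq = contradiction eq (lower≢upper i j)
    vertex-injective {i , suc zero} {j , zero}     eq = contradiction (sym eq) (lower≢upper j i)
    vertex-injective {i , suc zero} {j , suc zero} eq =
      cong (_, suc zero) (elem-injective M (opposite-≡ {k = suc zero} {l = suc zero} eq))

    vertex-surjective : ∀ {v} → v ∈ S → ∃[ s ] vertex s ≡ v
    vertex-surjective {v} v∈S with u , u∈S , v~u ← mate v∈S with Fin.<-cmp v u
    ... | tri< v<u _ _
      with i , eq ← elem-surjective M (∈-comprehension⁺ lowerEnd? (v∈S , u , u∈S , v~u , v<u)) =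
      (i , zero) , eq
    ... | tri≈ _ v≡u _ = contradiction v≡u (~⇒≢ v~u)
    -- The upper end recorded for `u` is some neighbour of `u` in `S`; uniqueness makes it `v`.
    ... | tri> _ _ u<v
      with i , refl ← elem-surjective M
             (∈-comprehension⁺ lowerEnd? (u∈S , v , v∈S , ~-sym v~u , u<v)) =
      (i , suc zero) , unique (vertex~ i zero) (~-sym v~u) (vertex∈S (i , suc zero)) v∈S

    open InducedMatching {a = a} unique vertex vertex∈S
      (λ {s} {t} → vertex-injective {s} {t}) vertex-surjective vertex~ public

  -- Structure of an open packing with L₂ vertices.

  module _ (acyclic : ¬ Cycle G) (hasNeighbour : ∀ v → ∃[ u ] v ~ u)
    {S} (packing : OpenPacking G S) (L₂≤∣S∣ : L₂ G ≤ ∣ S ∣)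
    where

    private
      unique : AtMostOneNeighbourIn S
      unique = openPacking⁻ packing

      limited : TwoLimitedPacking G S
      limited = openPacking⇒twoLimited packing

      no-larger : ∀ {B} → ∣ S ∣ < ∣ B ∣ → ¬ TwoLimitedPacking G B
      no-larger ∣S∣<∣B∣ limitedB = <⇒≱ ∣S∣<∣B∣ (≤-trans (∣B∣≤L₂ limitedB) L₂≤∣S∣)

      Matched : Fin n → Set
      Matched v = v ∈ S × ∃[ u ] u ∈ S × v ~ u

      matched? : Decidable Matched
      matched? v = (v ∈? S) ×-dec Fin.any? λ u → (u ∈? S) ×-dec adj? G v u

      -- Two vertices of `S` in `N[ G , v ]` cannot both be neighbours of `v`, so one is `v` and `v`
      -- is matched. Unmatched vertices thus leave room for one new vertex.
      ∣N[v]∩S∣≤1 : ∀ {v} → ¬ Matched v → ∣ N[ G , v ] ∩ S ∣ ≤ 1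
      ∣N[v]∩S∣≤1 {v} ¬matched = subsingleton⇒∣p∣≤1 λ x∈ y∈ →
        go (∈-N[]∩⁻ {S = S} x∈) (∈-N[]∩⁻ {S = S} y∈)
        where
        go : ∀ {x y} → (x ≡ v ⊎ v ~ x) × x ∈ S → (y ≡ v ⊎ v ~ y) × y ∈ S → x ≡ y
        go (inj₁ refl , _)   (inj₁ refl , _)   = refl
        go (inj₁ refl , v∈S) (inj₂ v~y , y∈S)  = contradiction (v∈S , _ , y∈S , v~y) ¬matched
        go (inj₂ v~x , x∈S)  (inj₁ refl , v∈S) = contradiction (v∈S , _ , x∈S , v~x) ¬matched
        go (inj₂ v~x , x∈S)  (inj₂ v~y , y∈S)  = unique v~x v~y x∈S y∈S

      -- Otherwise `x` could be added to `S`: matched vertices do not see `x`, and unmatched ones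
      -- have room for it.
      matchedNeighbour : ∀ {x} → x ∉ S → ∃[ v ] x ~ v × Matched v
      matchedNeighbour {x} x∉S with Fin.any? (λ v → adj? G x v ×-dec matched? v)
      ... | yes found = found
      ... | no ¬found = contradiction limited′ (no-larger (x∉p⇒∣p∣<∣p∪⁅x⁆∣ x∉S))
        where
        limited′ : TwoLimitedPacking G (S ∪ ⁅ x ⁆)
        limited′ w with matched? w
        ... | yes mw = ≤-trans (p⊆q⇒∣p∣≤∣q∣ ⊆S) (limited w)
          where
          ⊆S : N[ G , w ] ∩ (S ∪ ⁅ x ⁆) ⊆ N[ G , w ] ∩ S
          ⊆S z∈ with x∈p∩q⁻ N[ G , w ] (S ∪ ⁅ x ⁆) z∈
          ... | z∈N , z∈S∪x with x∈p∪q⁻ S ⁅ x ⁆ z∈S∪x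
          ...   | inj₁ z∈S = x∈p∩q⁺ (z∈N , z∈S)
          ...   | inj₂ z∈x with refl ← x∈⁅y⁆⇒x≡y x z∈x with ∈-N[]⁻ z∈N
          ...     | inj₁ refl = contradiction (proj₁ mw) x∉S
          ...     | inj₂ w~x  = contradiction (w , ~-sym w~x , mw) ¬found
        ... | no ¬mw = ≤-trans (p⊆q⇒∣p∣≤∣q∣ ⊆S∪x)
          (≤-trans (∣p∪⁅x⁆∣≤1+∣p∣ (N[ G , w ] ∩ S) x) (s≤s (∣N[v]∩S∣≤1 ¬mw)))
          where
          ⊆S∪x : N[ G , w ] ∩ (S ∪ ⁅ x ⁆) ⊆ (N[ G , w ] ∩ S) ∪ ⁅ x ⁆
          ⊆S∪x z∈ with x∈p∩q⁻ N[ G , w ] (S ∪ ⁅ x ⁆) z∈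
          ... | z∈N , z∈S∪x with x∈p∪q⁻ S ⁅ x ⁆ z∈S∪x
          ...   | inj₁ z∈S = p⊆p∪q ⁅ x ⁆ (x∈p∩q⁺ (z∈N , z∈S))
          ...   | inj₂ z∈x = q⊆p∪q (N[ G , w ] ∩ S) ⁅ x ⁆ z∈x

      -- If `v` were unmatched, it would have a neighbour `x` outside `S`. The matched neighbour of
      -- `x` would then be `v`, the only neighbour of `x` in `S`.
      mate : ∀ {v} → v ∈ S → ∃[ u ] u ∈ S × v ~ u
      mate {v} v∈S with matched? v
      ... | yes (_ , mate) = mate
      ... | no ¬matched with x , v~x ← hasNeighbour v with x ∈? S
      ...   | yes x∈S = contradiction (v∈S , x , x∈S , v~x) ¬matched
      ...   | no  x∉S
        with w , x~w , matched@(w∈S , _) ← matchedNeighbour x∉S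
        with refl ← unique x~w (~-sym v~x) w∈S v∈S = contradiction matched ¬matched

      -- Exchanging one end of a leafless matching edge for two new vertices.

      module Exchange {u v x y} (u∈S : u ∈ S) (v∈S : v ∈ S) (u~v : u ~ v)
        (u~x : u ~ x) (x≢v : x ≢ v) (v~y : v ~ y) (y≢u : y ≢ u)
        where

        x∉S : x ∉ S
        x∉S x∈S = x≢v (unique u~x u~v x∈S v∈S)

        y∉S : y ∉ S
        y∉S y∈S = y≢u (unique v~y (~-sym u~v) y∈S u∈S)

        x≢y : x ≢ y
        x≢y refl = triangle-free acyclic u~v v~y (~-sym u~x)

        -- On the path `x`, `u`, `v`, `y`, an edge from `y` to `x` closes a 4-cycle and a common
        -- neighbour `w` closes a 5-cycle; `w ∉ S` keeps `w` apart from `u` and `v`.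
        no-common : ∀ {w} → w ∉ S → w ~ x → ¬ (y ≡ w ⊎ w ~ y)
        no-common w∉S w~x (inj₁ refl) = C₄-free acyclic x≢v (≢-sym y≢u) (~-sym u~x) u~v v~y w~x
        no-common w∉S w~x (inj₂ w~y)  = C₅-free acyclic x≢v x≢y (≢-sym y≢u)
          (λ { refl → w∉S u∈S }) (λ { refl → w∉S v∈S }) (~-sym u~x) u~v v~y (~-sym w~y) w~x

        S′ B : Subset n
        S′ = (S - u) ∪ ⁅ x ⁆
        B  = S′ ∪ ⁅ y ⁆

        data Origin (z : Fin n) : Set where
          old : z ∈ S → z ≢ u → Origin z
          isX : z ≡ x → Origin z
          isY : z ≡ y → Origin z

        origin : ∀ {z} → z ∈ B → Origin z
        origin {z} z∈B with x∈p∪q⁻ S′ ⁅ y ⁆ z∈B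
        ... | inj₂ z∈y = isY (x∈⁅y⁆⇒x≡y y z∈y)
        ... | inj₁ z∈S′ with x∈p∪q⁻ (S - u) ⁅ x ⁆ z∈S′
        ...   | inj₂ z∈x = isX (x∈⁅y⁆⇒x≡y x z∈x)
        ...   | inj₁ z∈  = let z∈S , z≢u = x∈p-y⁻ S u z∈ in old z∈S z≢u

        ∣S∣<∣B∣ : ∣ S ∣ < ∣ B ∣
        ∣S∣<∣B∣ = begin-strict
          ∣ S ∣          ≤⟨ ∣p∣≤1+∣p-x∣ S u ⟩
          suc ∣ S - u ∣  ≤⟨ x∉p⇒∣p∣<∣p∪⁅x⁆∣ (x∉S ∘ p─q⊆p S ⁅ u ⁆) ⟩
          ∣ S′ ∣         <⟨ x∉p⇒∣p∣<∣p∪⁅x⁆∣ y∉S′ ⟩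
          ∣ B ∣          ∎
          where
          open ≤-Reasoning
          y∉S′ : y ∉ S′
          y∉S′ y∈ with x∈p∪q⁻ (S - u) ⁅ x ⁆ y∈
          ... | inj₁ y∈S-u = y∉S (p─q⊆p S ⁅ u ⁆ y∈S-u)
          ... | inj₂ y∈x   = x≢y (sym (x∈⁅y⁆⇒x≡y x y∈x))

        Bound : Fin n → Subset n → Set
        Bound w p = ∀ {z} → z ≡ w ⊎ w ~ z → Origin z → z ∈ p

        bounded : ∀ {w p} → Bound w p → N[ G , w ] ∩ B ⊆ p
        bounded bound z∈ = let z∈N , z∈B = ∈-N[]∩⁻ {S = B} z∈ in bound z∈N (origin z∈B)

        two : ∀ {w} s t → (∀ {z} → z ≡ w ⊎ w ~ z → Origin z → z ≡ s ⊎ z ≡ t) →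
              ∣ N[ G , w ] ∩ B ∣ ≤ 2
        two s t bound = p⊆⁅x⁆∪⁅y⁆⇒∣p∣≤2 s t (bounded λ z∈N o → mem (bound z∈N o))
          where
          mem : ∀ {z} → z ≡ s ⊎ z ≡ t → z ∈ ⁅ s ⁆ ∪ ⁅ t ⁆
          mem (inj₁ refl) = p⊆p∪q ⁅ t ⁆ (x∈⁅x⁆ s)
          mem (inj₂ refl) = q⊆p∪q ⁅ s ⁆ ⁅ t ⁆ (x∈⁅x⁆ t)

        -- Outside `S` a closed neighbourhood meets `S` at most once, so a single new vertex `t`
        -- fits.
        one-new : ∀ {w} t → w ∉ S →
          (∀ {z} → z ≡ w ⊎ w ~ z → Origin z → z ∈ S ⊎ z ≡ t) → ∣ N[ G , w ] ∩ B ∣ ≤ 2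
        one-new {w} t w∉S bound = ≤-trans (p⊆q⇒∣p∣≤∣q∣ (bounded mem))
          (≤-trans (∣p∪⁅x⁆∣≤1+∣p∣ (N[ G , w ] ∩ S) t) (s≤s (∣N[v]∩S∣≤1 (w∉S ∘ proj₁))))
          where
          mem : Bound w ((N[ G , w ] ∩ S) ∪ ⁅ t ⁆)
          mem z∈N o with bound z∈N o
          ... | inj₁ z∈S  = p⊆p∪q ⁅ t ⁆ (x∈p∩q⁺ (∈-N[]⁺ z∈N , z∈S))
          ... | inj₂ refl = q⊆p∪q (N[ G , w ] ∩ S) ⁅ t ⁆ (x∈⁅x⁆ t)

        -- `u` has left, `v` is its only neighbour in `S`, and `y` would close a triangle.
        at-u : ∣ N[ G , u ] ∩ B ∣ ≤ 2
        at-u = two v x λ where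
          (inj₁ refl) (old _ z≢u)   → contradiction refl z≢u
          (inj₂ u~z)  (old z∈S _)   → inj₁ (unique u~z u~v z∈S v∈S)
          _           (isX z≡x)     → inj₂ z≡x
          (inj₁ z≡u)  (isY refl)    → contradiction z≡u y≢u
          (inj₂ u~y)  (isY refl)    →
            contradiction (~-sym u~y) (triangle-free acyclic u~v v~y)

        -- Here `y` takes the place of `u`, and `x` would close a triangle.
        at-v : ∣ N[ G , v ] ∩ B ∣ ≤ 2
        at-v = two v y λ where
          (inj₁ z≡v)  (old _ _)     → inj₁ z≡v
          (inj₂ v~z)  (old z∈S z≢u) → contradiction (unique v~z (~-sym u~v) z∈S u∈S) z≢u
          (inj₁ z≡v)  (isX refl)    → contradiction z≡v x≢v
          (inj₂ v~x)  (isX refl)    →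
            contradiction (~-sym u~x) (triangle-free acyclic u~v v~x)
          _           (isY z≡y)     → inj₂ z≡y

        -- The only neighbours of `x` and `y` in `S` are `u` and `v` respectively, so `N[ G , w ]`
        -- gains nothing.
        at-S : ∀ {w} → w ∈ S → w ≢ u → w ≢ v → ∣ N[ G , w ] ∩ B ∣ ≤ 2
        at-S {w} w∈S w≢u w≢v = ≤-trans (p⊆q⇒∣p∣≤∣q∣ (bounded mem)) (limited w)
          where
          mem : Bound w (N[ G , w ] ∩ S)
          mem z∈N         (old z∈S _) = x∈p∩q⁺ (∈-N[]⁺ z∈N , z∈S)
          mem (inj₁ refl) (isX refl)  = contradiction w∈S x∉S
          mem (inj₂ w~x)  (isX refl)  =
            contradiction (unique (~-sym w~x) (~-sym u~x) w∈S u∈S) w≢u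
          mem (inj₁ refl) (isY refl)  = contradiction w∈S y∉S
          mem (inj₂ w~y)  (isY refl)  =
            contradiction (unique (~-sym w~y) (~-sym v~y) w∈S v∈S) w≢v

        -- The only neighbour of `x` in `S` is the removed `u`, which leaves at most `x` and `y`.
        at-x : ∣ N[ G , x ] ∩ B ∣ ≤ 2
        at-x = two x y λ where
          (inj₁ z≡x) _             → inj₁ z≡x
          (inj₂ x~z) (old z∈S z≢u) → contradiction (unique x~z (~-sym u~x) z∈S u∈S) z≢u
          _          (isX z≡x)     → inj₁ z≡x
          _          (isY z≡y)     → inj₂ z≡y

        -- By `no-common` at most one of `x` and `y` is new here; adjacency to `x` decides which.
        at-∉S : ∀ {w} → w ∉ S → w ≢ x → ∣ N[ G , w ] ∩ B ∣ ≤ 2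
        at-∉S {w} w∉S w≢x with adj? G w x
        ... | yes w~x = one-new x w∉S λ where
          _   (old z∈S _) → inj₁ z∈S
          _   (isX z≡x)   → inj₂ z≡x
          z∈N (isY refl)  → contradiction z∈N (no-common w∉S w~x)
        ... | no  w≁x = one-new y w∉S λ where
          _          (old z∈S _) → inj₁ z∈S
          (inj₁ x≡w) (isX refl)  → contradiction (sym x≡w) w≢x
          (inj₂ w~x) (isX refl)  → contradiction w~x w≁x
          _          (isY z≡y)   → inj₂ z≡y

        limitedB : TwoLimitedPacking G B
        limitedB w with w Fin.≟ u | w Fin.≟ v | w Fin.≟ x | w ∈? S
        ... | yes refl | _        | _        | _       = at-u
        ... | no _     | yes refl | _        | _       = at-v
        ... | no _     | no _     | yes refl | _       = at-x
        ... | no w≢u   | no w≢v   | no _     | yes w∈S = at-S w∈S w≢u w≢v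
        ... | no _     | no _     | no w≢x   | no w∉S  = at-∉S w∉S w≢x

        impossible : Absurd
        impossible = no-larger ∣S∣<∣B∣ limitedB

      -- Leaves on the matching edges and membership in 𝒯.

      anotherNeighbour : ∀ {u v} → u ~ v → degree G u ≢ 1 → ∃[ x ] u ~ x × x ≢ v
      anotherNeighbour {u} {v} u~v deg≢1
        with ∣p∣≰1⇒∃≢ (λ deg≤1 → deg≢1 (≤-antisym deg≤1 (∣p∣≥1 (∈-N⁺ u~v)))) v
      ... | x , x∈N , x≢v = x , ∈-N⁻ x∈N , x≢v

      leaf-end : ∀ {u v} → u ∈ S → v ∈ S → u ~ v → degree G u ≡ 1 ⊎ degree G v ≡ 1
      leaf-end {u} {v} u∈S v∈S u~v with degree G u ≟ 1 | degree G v ≟ 1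
      ... | yes du≡1 | _        = inj₁ du≡1
      ... | no _     | yes dv≡1 = inj₂ dv≡1
      ... | no du≢1  | no dv≢1
        with x , u~x , x≢v ← anotherNeighbour u~v du≢1
           | y , v~y , y≢u ← anotherNeighbour (~-sym u~v) dv≢1 =
        ⊥-elim (Exchange.impossible u∈S v∈S u~v u~x x≢v v~y y≢u)

      open PerfectlyMatched unique mate

      S-nonempty : Fin n → Nonempty S
      S-nonempty v with v ∈? S
      ... | yes v∈S = v , v∈S
      ... | no  v∉S = let w , _ , w∈S , _ = matchedNeighbour v∉S in w , w∈S

      a>0 : Fin n → 0 < a
      a>0 v with vertex-surjective (proj₂ (S-nonempty v))
      ... | (i , _) , _ = ≤-<-trans z≤n (Fin.toℕ<n i)

      leafInCopy′ : ∀ i → ∃[ j ] degree G (vertex (i , j)) ≡ 1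
      leafInCopy′ i with leaf-end (vertex∈S (i , zero)) (vertex∈S (i , suc zero)) (vertex~ i zero)
      ... | inj₁ d≡1 = zero , d≡1
      ... | inj₂ d≡1 = suc zero , d≡1

    maximum⇒𝒯 : IsTree G → Fin n → G ∈𝒯
    maximum⇒𝒯 tree v = record
      { isTree       = tree
      ; S₀           = S
      ; R₀           = ∁ S
      ; covering     = p∪∁p≡⊤ S
      ; disjoint     = ∩-inverseʳ S
      ; a            = a
      ; a-positive   = a>0 v
      ; iso          = iso
      ; leafInCopy   = leafInCopy′
      ; oneNeighbour = λ {r} r∈∁S →
          let w , r~w , w∈S , _ = matchedNeighbour (x∈∁p⇒x∉p r∈∁S)
          in ≤-antisym (packing r) (∣p∣≥1 (x∈p∩q⁺ (∈-N⁺ r~w , w∈S)))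
      }

-- Conclusion for nontrivial trees.

Star⇒step : {A : Set} {R : Rel A 0ℓ} {x y : A} → x ≢ y → Star R x y → ∃[ z ] R x z
Star⇒step x≢y ε         = contradiction refl x≢y
Star⇒step x≢y (Rxz ◅ _) = _ , Rxz

-- One of the vertices 0 and 1 differs from `v`, and the first edge of a walk to it ends in a
-- neighbour.
connected⇒hasNeighbour : (G : SimpleGraph (Fin n)) → 2 ≤ n → Connected G →
                         ∀ v → ∃[ u ] Adj G v u
connected⇒hasNeighbour G (s≤s (s≤s z≤n)) connected v with v Fin.≟ zero
... | yes refl = Star⇒step (λ ()) (connected zero (suc zero))
... | no  v≢0  = Star⇒step v≢0 (connected v zero)

theorem5p4 : ∀ (n : ℕ) (T : SimpleGraph (Fin n)) → 2 ≤ n → IsTree T →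
    (ρ⁰ T ≤ L₂ T × L₂ T ≤ 2 * ρ⁰ T) × (ρ⁰ T ≡ L₂ T ⇔ T ∈𝒯)
theorem5p4 n T 2≤n tree = (ρ⁰≤L₂ , L₂≤2ρ⁰ acyclic) , mk⇔ ρ⁰≡L₂⇒𝒯 𝒯⇒ρ⁰≡L₂
  where
  open Graph T
  open IsTree tree

  ρ⁰≡L₂⇒𝒯 : ρ⁰ T ≡ L₂ T → T ∈𝒯
  ρ⁰≡L₂⇒𝒯 ρ⁰≡L₂ with S , packing , ∣S∣≡ρ⁰ ← maximumOpenPacking =
    maximum⇒𝒯 acyclic (connected⇒hasNeighbour T 2≤n connected) packing
      (≤-reflexive (sym (trans ∣S∣≡ρ⁰ ρ⁰≡L₂))) tree (fromℕ< (≤-trans (s≤s z≤n) 2≤n))
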